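{- Let $(\Gamma,\pi)$ be the following 2-edge-colored planar graph of girth 4. Its vertices are $a,b,z$ and $x_0,x_1,\dots,x_{11}$. Its edges of color $0$ are $$x_0a,\ ax_2,\ x_2b,\ bx_0,\ x_0x_1,\ x_4x_3,\ x_3a,\ ax_5,\ x_7x_6,\ x_6b,\ bx_8,\ x_{10}x_9,$$ and its edges of color $1$ are $$zx_0,\ x_1x_2,\ x_4x_5,\ x_5b,\ bx_3,\ x_7x_8,\ x_8a,\ ax_6,\ x_{10}x_{11},\ x_{11}a,\ ax_9,\ x_9b,\ bx_{11}.$$ Then $(\Gamma,\pi)$ admits no $3$-inversion.
   Context: A 2-edge-colored graph $(G,\pi)$ is a finite simple graph $G$ with a map $\pi:E(G)\to\mathbb{F}_2$. For a positive integer $t$, a $t$-inversion of $(G,\pi)$ is an assignment of a vector $\mathbf{u}\in\mathbb{F}_2^t$ to each vertex $u\in V(G)$ such that $\pi(uv)=\mathbf{u}\cdot\mathbf{v}$ (standard dot product over $\mathbb{F}_2$) for every edge $uv\in E(G)$. -}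

module Defs where

open import Data.Fin using (Fin; zero; suc; toℕ; #_)
import Data.Fin.Properties as Fin
open import Data.List using (List; []; _∷_; reverse)
open import Data.List.Membership.Propositional using (_∈_; _∉_)
import Data.List.Membership.DecPropositional as DecMembership
open import Data.List.Relation.Unary.All using (All; all?; lookup)
open import Data.Nat using (ℕ; suc; NonZero)
import Data.Nat as ℕ
open import Data.Parity using (Parity; 0ℙ; 1ℙ)
import Data.Parity as ℙ
open import Data.Product using (∃-syntax; _×_; _,_; proj₁; proj₂; swap)
open import Data.Product.Properties using (≡-dec)
open import Data.Rational using (ℚ; 0ℚ; 1ℚ; _+_; _*_; _-_; _≤_)
open import Data.Sum using (_⊎_; inj₁; inj₂)
import Data.Sum as Sum
open import Data.Vec using (Vec; foldr′; zipWith)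
open import Function using (_↔_; mk↔ₛ′; Injective)
open import Function.Properties.Inverse using (↔⇒↣)
open import Level using (0ℓ)
open import Relation.Binary using (Rel; Symmetric; Irreflexive; DecidableEquality)
open import Relation.Binary.PropositionalEquality using (_≡_; refl; cong)
open import Relation.Nullary using (¬_; ¬?; _×-dec_; contradiction)
open import Relation.Nullary.Decidable using (from-yes; via-injection)

record SimpleGraph : Set₁ where
  field
    V      : Set
    order  : ℕ
    finite : V ↔ Fin order
    Adj    : Rel V 0ℓ
    sym    : Symmetric Adj
    irrefl : Irreflexive _≡_ Adj

-- 𝔽₂ is the library's two-element field `Parity`.
-- `Adj u v` need not be a proposition, and an edge has two orientations; the
-- laws of `π` make it a function of the unordered pair {u , v}.
record 2EdgeColoredGraph : Set₁ where
  field
    graph : SimpleGraph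
  open SimpleGraph graph public
  field
    π        : ∀ {u v} → Adj u v → Parity
    π-unique : ∀ {u v} (e e′ : Adj u v) → π e ≡ π e′
    π-sym    : ∀ {u v} (e : Adj u v) → π (sym e) ≡ π e

infix 7 _·_

_·_ : ∀ {t} → Vec Parity t → Vec Parity t → Parity
u · v = foldr′ ℙ._+_ 0ℙ (zipWith ℙ._*_ u v)

record Inversion (G : 2EdgeColoredGraph) (t : ℕ) .{{_ : NonZero t}} : Set where
  open 2EdgeColoredGraph G
  field
    vec     : V → Vec Parity t
    inverts : ∀ {u v} (e : Adj u v) → π e ≡ vec u · vec v

record Cycle (G : SimpleGraph) (n : ℕ) : Set where
  open SimpleGraph G
  field
    3≤n       : 3 ℕ.≤ n
    vertex    : Fin n → V
    injective : Injective _≡_ _≡_ vertex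
    step      : ∀ {i j} → suc (toℕ i) ≡ toℕ j → Adj (vertex i) (vertex j)
    close     : ∀ {i j} → suc (toℕ i) ≡ n → toℕ j ≡ 0 → Adj (vertex i) (vertex j)

HasGirth : SimpleGraph → ℕ → Set
HasGirth G g = Cycle G g × (∀ n → Cycle G n → g ℕ.≤ n)

Point : Set
Point = ℚ × ℚ

OnSegment : Point → Point → Point → Set
OnSegment (p₁ , p₂) (q₁ , q₂) (r₁ , r₂) =
  ∃[ s ] 0ℚ ≤ s × s ≤ 1ℚ ×
         r₁ ≡ (1ℚ - s) * p₁ + s * q₁ ×
         r₂ ≡ (1ℚ - s) * p₂ + s * q₂

-- `OnPolyline p bs q r`: r lies on the polygonal curve from p to q whose
-- successive bends are bs.
OnPolyline : Point → List Point → Point → Point → Set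
OnPolyline p []       q r = OnSegment p q r
OnPolyline p (b ∷ bs) q r = OnSegment p b r ⊎ OnPolyline b bs q r

-- A drawing without crossings, with edges drawn as polygonal curves through
-- rational points; a finite graph has such a drawing iff it embeds in ℝ².
-- Looking only at rational points loses no crossing: two segments with rational
-- ends that meet in ℝ² meet in a single rational point or in a segment with
-- rational ends.  A curve may cross itself, which is harmless as it contains a
-- simple polygonal arc between its two (distinct) ends.
record PlaneDrawing (G : SimpleGraph) : Set where
  open SimpleGraph G
  field
    pos       : V → Point
    injective : Injective _≡_ _≡_ pos
    bends     : V → V → List Point
    bends-sym : ∀ u v → bends v u ≡ reverse (bends u v)

  OnEdge : V → V → Point → Set
  OnEdge u v = OnPolyline (pos u) (bends u v) (pos v)

  field
    avoids-vertices : ∀ {u v w} → Adj u v → OnEdge u v (pos w) → w ≡ u ⊎ w ≡ v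
    no-crossing     : ∀ {u v u′ v′ r} → Adj u v → Adj u′ v′ →
                      ¬ ((u ≡ u′ × v ≡ v′) ⊎ (u ≡ v′ × v ≡ u′)) →
                      OnEdge u v r → OnEdge u′ v′ r → ∃[ w ] r ≡ pos w

Planar : SimpleGraph → Set
Planar = PlaneDrawing

data Vertex : Set where
  a b z : Vertex
  x     : Fin 12 → Vertex

edges : Parity → List (Vertex × Vertex)
edges 0ℙ =
  (x (# 0) , a) ∷ (a , x (# 2)) ∷ (x (# 2) , b) ∷ (b , x (# 0)) ∷
  (x (# 0) , x (# 1)) ∷
  (x (# 4) , x (# 3)) ∷ (x (# 3) , a) ∷ (a , x (# 5)) ∷
  (x (# 7) , x (# 6)) ∷ (x (# 6) , b) ∷ (b , x (# 8)) ∷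
  (x (# 10) , x (# 9)) ∷ []
edges 1ℙ =
  (z , x (# 0)) ∷ (x (# 1) , x (# 2)) ∷
  (x (# 4) , x (# 5)) ∷ (x (# 5) , b) ∷ (b , x (# 3)) ∷
  (x (# 7) , x (# 8)) ∷ (x (# 8) , a) ∷ (a , x (# 6)) ∷
  (x (# 10) , x (# 11)) ∷ (x (# 11) , a) ∷ (a , x (# 9)) ∷
  (x (# 9) , b) ∷ (b , x (# 11)) ∷ []

Joined : Parity → Rel Vertex 0ℓ
Joined c u v = (u , v) ∈ edges c ⊎ (v , u) ∈ edges c

Vertex↔Fin : Vertex ↔ Fin 15
Vertex↔Fin = mk↔ₛ′ to from to∘from from∘to
  where
  to : Vertex → Fin 15
  to a     = zero
  to b     = suc zero
  to z     = suc (suc zero)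
  to (x i) = suc (suc (suc i))

  from : Fin 15 → Vertex
  from zero                = a
  from (suc zero)          = b
  from (suc (suc zero))    = z
  from (suc (suc (suc i))) = x i

  to∘from : ∀ i → to (from i) ≡ i
  to∘from zero                = refl
  to∘from (suc zero)          = refl
  to∘from (suc (suc zero))    = refl
  to∘from (suc (suc (suc i))) = refl

  from∘to : ∀ v → from (to v) ≡ v
  from∘to a     = refl
  from∘to b     = refl
  from∘to z     = refl
  from∘to (x i) = refl

_≟_ : DecidableEquality Vertex
_≟_ = via-injection (↔⇒↣ Vertex↔Fin) Fin._≟_

open DecMembership (≡-dec _≟_ _≟_) using (_∈?_)

loopless : ∀ c {v} → (v , v) ∉ edges c
loopless c {v} v∈ = lookup (check c) v∈ refl
  where
  check : ∀ c → All (λ (u , v) → ¬ u ≡ v) (edges c)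
  check 0ℙ = from-yes (all? (λ (u , v) → ¬? (u ≟ v)) (edges 0ℙ))
  check 1ℙ = from-yes (all? (λ (u , v) → ¬? (u ≟ v)) (edges 1ℙ))

edges-disjoint : All (λ e → e ∉ edges 1ℙ × swap e ∉ edges 1ℙ) (edges 0ℙ)
edges-disjoint = from-yes
  (all? (λ e → ¬? (e ∈? edges 1ℙ) ×-dec ¬? (swap e ∈? edges 1ℙ)) (edges 0ℙ))

colors-disjoint : ∀ {u v} → Joined 0ℙ u v → ¬ Joined 1ℙ u v
colors-disjoint (inj₁ p) (inj₁ q) = proj₁ (lookup edges-disjoint p) q
colors-disjoint (inj₁ p) (inj₂ q) = proj₂ (lookup edges-disjoint p) q
colors-disjoint (inj₂ p) (inj₁ q) = proj₂ (lookup edges-disjoint p) q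
colors-disjoint (inj₂ p) (inj₂ q) = proj₁ (lookup edges-disjoint p) q

color-unique : ∀ {u v} c c′ → Joined c u v → Joined c′ u v → c ≡ c′
color-unique 0ℙ 0ℙ _ _ = refl
color-unique 0ℙ 1ℙ p q = contradiction q (colors-disjoint p)
color-unique 1ℙ 0ℙ p q = contradiction p (colors-disjoint q)
color-unique 1ℙ 1ℙ _ _ = refl

Γ : SimpleGraph
Γ = record
  { V      = Vertex
  ; order  = 15
  ; finite = Vertex↔Fin
  ; Adj    = λ u v → ∃[ c ] Joined c u v
  ; sym    = λ (c , e) → c , Sum.swap e
  ; irrefl = λ { refl (c , inj₁ e) → loopless c e
               ; refl (c , inj₂ e) → loopless c e }
  }

Γ,π : 2EdgeColoredGraph
Γ,π = record
  { graph    = Γ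
  ; π        = proj₁
  ; π-unique = λ (c , e) (c′ , e′) → color-unique c c′ e e′
  ; π-sym    = λ _ → refl
  }

-- Planarity: put z, x₀, …, x₁₁ on the x-axis in this order, a above and b below
-- it, and draw every edge as a straight segment.  Two such segments are separated
-- by a line that meets one of them only in an end.
-- Girth: Γ is bipartite, so it has no triangle, and x₀ a x₂ b is a 4-cycle.
-- Inversions: x₀ and x₂ are orthogonal to a and b.  The edges zx₀, x₀x₁, x₁x₂ make
-- x₀ and x₂ distinct and nonzero, hence independent, so in 𝔽₂³ only one nonzero
-- vector is orthogonal to both.  But a ≠ 0 by ax₆, b ≠ 0 by bx₃, and a ≠ b by
-- x₃a, bx₃.
module Submission where

open import Defs
open import Data.Product using (_×_)
open import Data.Nat using (nonZero)
open import Relation.Nullary using (¬_)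

open import Data.Fin using (Fin; toℕ; #_)
import Data.Fin.Properties as Fin
open import Data.Integer using (+_)
import Data.Integer as ℤ
import Data.Integer.Properties as ℤ
open import Data.List using ([])
import Data.List.Membership.DecPropositional as DecMembership
open import Data.List.Relation.Unary.All using (All; all?; lookup)
open import Data.Nat using (ℕ)
import Data.Nat as ℕ
import Data.Nat.Coprimality as Coprime
import Data.Nat.Properties as ℕ
open import Data.Parity using (Parity; 0ℙ; 1ℙ; _⁻¹)
import Data.Parity as ℙ
import Data.Parity.Properties as ℙ
open import Data.Product using (∃-syntax; _,_; proj₁; proj₂)
open import Data.Product.Properties using (≡-dec)
open import Data.Rational
  using (ℚ; 0ℚ; 1ℚ; mkℚ; _+_; _*_; _-_; -_; _≤_; _<_; *≤*; *<*; ↥_; nonNegative; positive)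
open import Data.Rational.Properties hiding (_≟_)
import Data.Rational.Properties as ℚ
import Data.Rational.Solver as ℚ
open import Data.Sum using (_⊎_; inj₁; inj₂; [_,_]′)
import Data.Sum as Sum
open import Data.Vec using (Vec; []; _∷_; replicate)
import Data.Vec as Vec
import Data.Vec.Properties as Vec
open import Function using (_∘_)
open import Relation.Binary using (tri<; tri≈; tri>)
open import Relation.Binary.PropositionalEquality
  using (_≡_; _≢_; refl; sym; trans; cong; cong₂; subst; module ≡-Reasoning)
open import Relation.Nullary using (Dec; yes; no; contradiction; _→-dec_; _⊎-dec_; _×-dec_; ¬?)
open import Relation.Nullary.Decidable using (from-yes; map′; True; toWitness)
open import Relation.Unary using (Decidable)

open SimpleGraph Γ using (Adj)
open ℚ.+-*-Solver using (solve; _:=_; _:+_; _:*_; _:-_; :-_; con)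

-- Separation of segments

-- Required only along segments, with the very parameter `s` that witnesses `OnSegment`; convexity
-- estimates need no more.
Affine : (Point → ℚ) → Set
Affine g = ∀ {p q r} ((s , _) : OnSegment p q r) → g r ≡ (1ℚ - s) * g p + s * g q

neg-affine : ∀ {g} → Affine g → Affine (-_ ∘ g)
neg-affine {g} g-affine {p} {q} on@(s , _) = trans (cong -_ (g-affine on))
  (solve 3 (λ s p q → :- ((con 1ℚ :- s) :* p :+ s :* q) :=
                      (con 1ℚ :- s) :* (:- p) :+ s :* (:- q)) refl s (g p) (g q))

0≤1-s : ∀ {s} → s ≤ 1ℚ → 0ℚ ≤ 1ℚ - s
0≤1-s {s} s≤1 = subst (_≤ 1ℚ - s) (+-inverseʳ s) (+-monoˡ-≤ (- s) s≤1)

OnSegment-sym : ∀ {p q r} → OnSegment p q r → OnSegment q p r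
OnSegment-sym {p₁ , p₂} {q₁ , q₂} (s , 0≤s , s≤1 , refl , refl) =
  1ℚ - s , 0≤1-s s≤1 , 1-s≤1 , flip p₁ q₁ , flip p₂ q₂
  where
  1-s≤1 : 1ℚ - s ≤ 1ℚ
  1-s≤1 = subst (1ℚ - s ≤_) (+-identityʳ 1ℚ) (+-monoʳ-≤ 1ℚ (neg-antimono-≤ 0≤s))
  flip : ∀ p q → (1ℚ - s) * p + s * q ≡ (1ℚ - (1ℚ - s)) * q + (1ℚ - s) * p
  flip = solve 3 (λ s p q → (con 1ℚ :- s) :* p :+ s :* q :=
    (con 1ℚ :- (con 1ℚ :- s)) :* q :+ (con 1ℚ :- s) :* p) refl s

average : ∀ s c → (1ℚ - s) * c + s * c ≡ c
average = solve 2 (λ s c → (con 1ℚ :- s) :* c :+ s :* c := c) refl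

affine-≤ : ∀ {g c p q r} → Affine g → OnSegment p q r → g p ≤ c → g q ≤ c → g r ≤ c
affine-≤ {g} {c} {p} {q} {r} g-affine on@(s , 0≤s , s≤1 , _) gp≤c gq≤c = begin
  g r                        ≡⟨ g-affine on ⟩
  (1ℚ - s) * g p + s * g q   ≤⟨ +-mono-≤ (*-monoˡ-≤-nonNeg (1ℚ - s) gp≤c) (*-monoˡ-≤-nonNeg s gq≤c) ⟩
  (1ℚ - s) * c + s * c       ≡⟨ average s c ⟩
  c                          ∎
  where
  open ≤-Reasoning
  instance
    _ = nonNegative 0≤s
    _ = nonNegative (0≤1-s s≤1)

-- For `s` = 0 the point is `p` itself. For `s` > 0 the end `q` has positive weight, and its strict
-- inequality pushes `g r` above `c`.
affine-touch : ∀ {g c p q r} → Affine g → OnSegment p q r →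
               c ≤ g p → c < g q → g r ≤ c → r ≡ p
affine-touch {g} {c} {p} {q} {r} g-affine on@(s , 0≤s , s≤1 , r₁≡ , r₂≡) c≤gp c<gq gr≤c
  with <-cmp 0ℚ s
... | tri> _ _ s<0 = contradiction (<-≤-trans s<0 0≤s) (<-irrefl refl)
... | tri≈ _ refl _ = cong₂ _,_ (trans r₁≡ (start (proj₁ p) (proj₁ q)))
                               (trans r₂≡ (start (proj₂ p) (proj₂ q)))
  where
  start : ∀ p q → (1ℚ - 0ℚ) * p + 0ℚ * q ≡ p
  start = solve 2 (λ p q → (con 1ℚ :- con 0ℚ) :* p :+ con 0ℚ :* q := p) refl
... | tri< 0<s _ _ = contradiction (<-≤-trans c<gr gr≤c) (<-irrefl refl)
  where
  instance
    _ = positive 0<s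
    _ = nonNegative (0≤1-s s≤1)
  c<gr : c < g r
  c<gr = begin-strict
    c                         ≡⟨ average s c ⟨
    (1ℚ - s) * c + s * c      <⟨ +-mono-≤-< (*-monoˡ-≤-nonNeg (1ℚ - s) c≤gp) (*-monoʳ-<-pos s c<gq) ⟩
    (1ℚ - s) * g p + s * g q  ≡⟨ g-affine on ⟨
    g r                       ∎
    where open ≤-Reasoning

-- The line g = c separates the segments, and the first can touch it only in `p`. By convexity the
-- second keeps any common point in g ≤ c.
separated : ∀ {g c p q p′ q′ r} → Affine g → OnSegment p q r → OnSegment p′ q′ r →
            c ≤ g p → c < g q → g p′ ≤ c → g q′ ≤ c → r ≡ p
separated {g} g-affine on on′ c≤gp c<gq gp′≤c gq′≤c =
  affine-touch {g} g-affine on c≤gp c<gq (affine-≤ {g} g-affine on′ gp′≤c gq′≤c)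

separated′ : ∀ {g c p q p′ q′ r} → Affine g → OnSegment p q r → OnSegment p′ q′ r →
             g p ≤ c → g q < c → c ≤ g p′ → c ≤ g q′ → r ≡ p
separated′ {g} g-affine on on′ gp≤c gq<c c≤gp′ c≤gq′ =
  separated { -_ ∘ g } (neg-affine {g} g-affine) on on′ (neg-antimono-≤ gp≤c) (neg-antimono-< gq<c)
    (neg-antimono-≤ c≤gp′) (neg-antimono-≤ c≤gq′)

-- The drawing

-- Built in lowest terms by hand so that numerator and denominator compute for a variable `k`; order
-- and injectivity then reduce to the integers.
ι : ℕ → ℚ
ι k = mkℚ (+ k) 0 (Coprime.sym (Coprime.1-coprimeTo k))

ι-mono-≤ : ∀ {k l} → k ℕ.≤ l → ι k ≤ ι l
ι-mono-≤ k≤l = *≤* (ℤ.*-monoʳ-≤-nonNeg (+ 1) (ℤ.+≤+ k≤l))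

ι-mono-< : ∀ {k l} → k ℕ.< l → ι k < ι l
ι-mono-< k<l = *<* (ℤ.*-monoʳ-<-pos (+ 1) (ℤ.+<+ k<l))

data Side : Set where
  above below : Side

height : Side → ℚ
height above = 1ℚ
height below = - 1ℚ

apex : Side → Point
apex σ = 0ℚ , height σ

axis : ℕ → Point
axis k = ι k , 0ℚ

-- A family larger than the edge set of Γ: with arbitrary columns, comparing indices settles all
-- pairs of segments uniformly.
data Piece : Set where
  spoke : Side → ℕ → Piece
  link  : ℕ → Piece

start finish : Piece → Point
start  (spoke σ k) = apex σ
start  (link k)    = axis k
finish (spoke σ k) = axis k
finish (link k)    = axis (ℕ.suc k)

On : Piece → Point → Set
On e = OnSegment (start e) (finish e)

IsEnd : Piece → Point → Set
IsEnd e r = r ≡ start e ⊎ r ≡ finish e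

-- The level line ι m of `slope σ m` is the line through apex σ and axis m.
slope : Side → ℕ → Point → ℚ
slope σ m (p₁ , p₂) = p₁ + ι m * height σ * p₂

slope-affine : ∀ σ m → Affine (slope σ m)
slope-affine σ m {p₁ , p₂} {q₁ , q₂} (s , _ , _ , refl , refl) =
  solve 6 (λ s p₁ p₂ q₁ q₂ c →
      (con 1ℚ :- s) :* p₁ :+ s :* q₁ :+ c :* ((con 1ℚ :- s) :* p₂ :+ s :* q₂) :=
      (con 1ℚ :- s) :* (p₁ :+ c :* p₂) :+ s :* (q₁ :+ c :* q₂))
    refl s p₁ p₂ q₁ q₂ (ι m * height σ)

slope-apex : ∀ σ m → slope σ m (apex σ) ≡ ι m
slope-apex above m = solve 1 (λ m → con 0ℚ :+ m :* con 1ℚ :* con 1ℚ := m) refl (ι m)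
slope-apex below m = solve 1 (λ m → con 0ℚ :+ m :* con (- 1ℚ) :* con (- 1ℚ) := m) refl (ι m)

slope-axis : ∀ σ m k → slope σ m (axis k) ≡ ι k
slope-axis σ m k = solve 2 (λ k c → k :+ c :* con 0ℚ := k) refl (ι k) (ι m * height σ)

module Slope (σ : Side) (m : ℕ) where

  apex≤ : slope σ m (apex σ) ≤ ι m
  apex≤ = ≤-reflexive (slope-apex σ m)

  apex≥ : ι m ≤ slope σ m (apex σ)
  apex≥ = ≤-reflexive (sym (slope-apex σ m))

  axis≤ : ∀ {k} → k ℕ.≤ m → slope σ m (axis k) ≤ ι m
  axis≤ {k} k≤m = subst (_≤ ι m) (sym (slope-axis σ m k)) (ι-mono-≤ k≤m)

  axis≥ : ∀ {k} → m ℕ.≤ k → ι m ≤ slope σ m (axis k)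
  axis≥ {k} m≤k = subst (ι m ≤_) (sym (slope-axis σ m k)) (ι-mono-≤ m≤k)

  axis< : ∀ {k} → k ℕ.< m → slope σ m (axis k) < ι m
  axis< {k} k<m = subst (_< ι m) (sym (slope-axis σ m k)) (ι-mono-< k<m)

  axis> : ∀ {k} → m ℕ.< k → ι m < slope σ m (axis k)
  axis> {k} m<k = subst (ι m <_) (sym (slope-axis σ m k)) (ι-mono-< m<k)

  meet : ∀ {p q p′ q′ r} → OnSegment p q r → OnSegment p′ q′ r →
         ι m ≤ slope σ m p → ι m < slope σ m q →
         slope σ m p′ ≤ ι m → slope σ m q′ ≤ ι m → r ≡ p
  meet = separated {slope σ m} (slope-affine σ m)

  meet′ : ∀ {p q p′ q′ r} → OnSegment p q r → OnSegment p′ q′ r →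
          slope σ m p ≤ ι m → slope σ m q < ι m →
          ι m ≤ slope σ m p′ → ι m ≤ slope σ m q′ → r ≡ p
  meet′ = separated′ {slope σ m} (slope-affine σ m)

-- The factor `height σ` makes the side of `apex σ` the positive one, whichever side it is.
level : Side → Point → ℚ
level σ (_ , p₂) = height σ * p₂

level-affine : ∀ σ → Affine (level σ)
level-affine σ {_ , p₂} {_ , q₂} (s , _ , _ , refl , refl) =
  solve 4 (λ s p q h → h :* ((con 1ℚ :- s) :* p :+ s :* q) :=
                       (con 1ℚ :- s) :* (h :* p) :+ s :* (h :* q))
    refl s p₂ q₂ (height σ)

level-axis : ∀ σ k → level σ (axis k) ≡ 0ℚ
level-axis σ k = *-zeroʳ (height σ)

0<level-apex : ∀ σ → 0ℚ < level σ (apex σ)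
0<level-apex above = from-yes (0ℚ <? 1ℚ)
-- The level is (-1)(-1), which evaluates to 1.
0<level-apex below = from-yes (0ℚ <? 1ℚ)

-- The x-axis is the separating line; the spoke is reversed so that its end on the axis comes first.
spoke-meets-level : ∀ σ {k p q r} → level σ p ≤ 0ℚ → level σ q ≤ 0ℚ →
                    On (spoke σ k) r → OnSegment p q r → r ≡ axis k
spoke-meets-level σ {k} p≤0 q≤0 on on′ =
  separated {level σ} (level-affine σ) (OnSegment-sym on) on′
    (≤-reflexive (sym (level-axis σ k))) (0<level-apex σ) p≤0 q≤0

opposite-spokes : ∀ σ σ′ {k l r} → σ ≢ σ′ →
                  On (spoke σ k) r → On (spoke σ′ l) r → r ≡ axis k
opposite-spokes above above σ≢σ′ = contradiction refl σ≢σ′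
opposite-spokes below below σ≢σ′ = contradiction refl σ≢σ′
opposite-spokes above below _ =
  spoke-meets-level above (from-yes (- 1ℚ ≤? 0ℚ)) ≤-refl
opposite-spokes below above _ =
  spoke-meets-level below (from-yes (- 1ℚ ≤? 0ℚ)) ≤-refl

_≟ˢ_ : (σ σ′ : Side) → Dec (σ ≡ σ′)
above ≟ˢ above = yes refl
above ≟ˢ below = no λ ()
below ≟ˢ above = no λ ()
below ≟ˢ below = yes refl

-- Each case finds a line through one end of `e` that has the other end strictly on one side and
-- `e′` weakly on the other. It is the x-axis, or a line through an apex and an axis point.
pieces-meet-at-ends : ∀ e e′ {r} → e ≢ e′ → On e r → On e′ r → IsEnd e r
pieces-meet-at-ends (spoke σ k) (spoke σ′ l) e≢e′ on on′ with σ ≟ˢ σ′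
... | no σ≢σ′ = inj₂ (opposite-spokes σ σ′ σ≢σ′ on on′)
... | yes refl with ℕ.<-cmp k l
-- The separating line contains the whole spoke `e′`.
...   | tri< k<l _ _  = let open Slope σ l in
  inj₁ (meet′ on on′ apex≤ (axis< k<l) apex≥ (axis≥ ℕ.≤-refl))
...   | tri≈ _ refl _ = contradiction refl e≢e′
...   | tri> _ _ l<k  = let open Slope σ l in
  inj₁ (meet on on′ apex≥ (axis> l<k) apex≤ (axis≤ ℕ.≤-refl))
pieces-meet-at-ends (spoke σ k) (link l) _ on on′ =
  inj₂ (spoke-meets-level σ (≤-reflexive (level-axis σ l))
                            (≤-reflexive (level-axis σ (ℕ.suc l))) on on′)
pieces-meet-at-ends (link k) (spoke σ l) _ on on′ with l ℕ.≤? k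
... | yes l≤k = let open Slope σ k in
  inj₁ (meet on on′ (axis≥ ℕ.≤-refl) (axis> (ℕ.n<1+n k)) apex≤ (axis≤ l≤k))
... | no  l≰k = let open Slope σ (ℕ.suc k) in
  inj₂ (meet′ (OnSegment-sym on) on′
          (axis≤ ℕ.≤-refl) (axis< (ℕ.n<1+n k)) apex≥ (axis≥ (ℕ.≰⇒> l≰k)))
pieces-meet-at-ends (link k) (link l) e≢e′ on on′ with ℕ.<-cmp k l
-- The side `above` is an arbitrary choice: both links lie on the axis.
... | tri< k<l _ _  = let open Slope above (ℕ.suc k) in
  inj₂ (meet′ (OnSegment-sym on) on′
          (axis≤ ℕ.≤-refl) (axis< (ℕ.n<1+n k)) (axis≥ k<l) (axis≥ (ℕ.m≤n⇒m≤1+n k<l)))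
... | tri≈ _ refl _ = contradiction refl e≢e′
... | tri> _ _ l<k  = let open Slope above k in
  inj₁ (meet on on′
          (axis≥ ℕ.≤-refl) (axis> (ℕ.n<1+n k)) (axis≤ (ℕ.<⇒≤ l<k)) (axis≤ l<k))

-- Vertices and edges of Γ in the drawing

column : Vertex → ℕ
column (x i) = ℕ.suc (toℕ i)
-- The true column of z, and a dummy value for a and b.
column _     = 0

pos : Vertex → Point
pos a = apex above
pos b = apex below
pos v = axis (column v)

ι-injective : ∀ {k l} → ι k ≡ ι l → k ≡ l
ι-injective = ℤ.+-injective ∘ cong ↥_

-- In the omitted cases the coordinates have clashing constructors.
pos-injective : ∀ {u v} → pos u ≡ pos v → u ≡ v
pos-injective {a}   {a}   _  = refl
pos-injective {b}   {b}   _  = refl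
pos-injective {z}   {z}   _  = refl
pos-injective {x i} {x j} eq =
  cong x (Fin.toℕ-injective (ℕ.suc-injective (ι-injective (cong proj₁ eq))))

piece : Vertex → Vertex → Piece
piece a v = spoke above (column v)
piece b v = spoke below (column v)
piece u a = spoke above (column u)
piece u b = spoke below (column u)
-- A link is indexed by its left end.
piece u v = link (column u ℕ.⊓ column v)

Traces : Piece → Vertex → Vertex → Set
Traces e u v = (pos u ≡ start e × pos v ≡ finish e) ⊎ (pos v ≡ start e × pos u ≡ finish e)

traces? : ∀ e u v → Dec (Traces e u v)
traces? e u v = (pos u ≟ᵖ start e ×-dec pos v ≟ᵖ finish e) ⊎-dec
                (pos v ≟ᵖ start e ×-dec pos u ≟ᵖ finish e)
  where _≟ᵖ_ = ≡-dec ℚ._≟_ ℚ._≟_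

-- Evaluated edge by edge; this includes that edges drawn as links join consecutive columns.
edges-traced : ∀ c → All (λ (u , v) → Traces (piece u v) u v) (edges c)
edges-traced 0ℙ = from-yes (all? (λ (u , v) → traces? (piece u v) u v) (edges 0ℙ))
edges-traced 1ℙ = from-yes (all? (λ (u , v) → traces? (piece u v) u v) (edges 1ℙ))

adj-traced : ∀ {u v} → Adj u v → ∃[ e ] Traces e u v
adj-traced {u} {v} (c , inj₁ uv∈) = piece u v , lookup (edges-traced c) uv∈
adj-traced {u} {v} (c , inj₂ vu∈) = piece v u , Sum.swap (lookup (edges-traced c) vu∈)

-- Used in contrapositive form: distinct edges are drawn as distinct pieces.
traces-unique : ∀ {e u v u′ v′} → Traces e u v → Traces e u′ v′ →
                (u ≡ u′ × v ≡ v′) ⊎ (u ≡ v′ × v ≡ u′)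
traces-unique (inj₁ (p , q)) (inj₁ (p′ , q′)) =
  inj₁ (pos-injective (trans p (sym p′)) , pos-injective (trans q (sym q′)))
traces-unique (inj₁ (p , q)) (inj₂ (p′ , q′)) =
  inj₂ (pos-injective (trans p (sym p′)) , pos-injective (trans q (sym q′)))
traces-unique (inj₂ (p , q)) (inj₁ (p′ , q′)) =
  inj₂ (pos-injective (trans q (sym q′)) , pos-injective (trans p (sym p′)))
traces-unique (inj₂ (p , q)) (inj₂ (p′ , q′)) =
  inj₁ (pos-injective (trans q (sym q′)) , pos-injective (trans p (sym p′)))

traces-on : ∀ {e u v r} → Traces e u v → OnSegment (pos u) (pos v) r → On e r
traces-on (inj₁ (p , q)) on rewrite p | q = on
traces-on (inj₂ (p , q)) on rewrite p | q = OnSegment-sym on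

traces-end : ∀ {e u v r} → Traces e u v → IsEnd e r → r ≡ pos u ⊎ r ≡ pos v
traces-end (inj₁ (p , q)) = Sum.map (λ eq → trans eq (sym p)) (λ eq → trans eq (sym q))
traces-end (inj₂ (p , q)) = Sum.swap ∘ Sum.map (λ eq → trans eq (sym p)) (λ eq → trans eq (sym q))

on-start : ∀ {p q} → OnSegment p q p
on-start {p₁ , p₂} {q₁ , q₂} = 0ℚ , ≤-refl , from-yes (0ℚ ≤? 1ℚ) , begins p₁ q₁ , begins p₂ q₂
  where
  begins : ∀ p q → p ≡ (1ℚ - 0ℚ) * p + 0ℚ * q
  begins = solve 2 (λ p q → p := (con 1ℚ :- con 0ℚ) :* p :+ con 0ℚ :* q) refl

on-finish : ∀ {p q} → OnSegment p q q
on-finish = OnSegment-sym on-start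

spokes-differ : ∀ e {σ k σ′ k′} → spoke σ k ≢ spoke σ′ k′ → e ≢ spoke σ k ⊎ e ≢ spoke σ′ k′
spokes-differ (link _) _ = inj₁ (λ ())
spokes-differ (spoke τ j) {σ} {k} distinct with τ ≟ˢ σ | j ℕ.≟ k
... | yes refl | yes refl = inj₂ distinct
... | no τ≢σ   | _        = inj₁ λ { refl → τ≢σ refl }
... | _        | no j≢k   = inj₁ λ { refl → j≢k refl }

-- The spoke need not be an edge of Γ: two different spokes pass through every
-- vertex, so that a vertex on e is a meeting point of e with another piece.
spoke-through : ∀ e w → ∃[ σ ] ∃[ k ] e ≢ spoke σ k × On (spoke σ k) (pos w)
spoke-through e a with spokes-differ e {above} {0} {above} {1} (λ ())
... | inj₁ e≢ = above , 0 , e≢ , on-start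
... | inj₂ e≢ = above , 1 , e≢ , on-start
spoke-through e b with spokes-differ e {below} {0} {below} {1} (λ ())
... | inj₁ e≢ = below , 0 , e≢ , on-start
... | inj₂ e≢ = below , 1 , e≢ , on-start
spoke-through e z with spokes-differ e {above} {0} {below} {0} (λ ())
... | inj₁ e≢ = above , 0 , e≢ , on-finish
... | inj₂ e≢ = below , 0 , e≢ , on-finish
spoke-through e (x i) with spokes-differ e {above} {column (x i)} {below} {column (x i)} (λ ())
... | inj₁ e≢ = above , _ , e≢ , on-finish
... | inj₂ e≢ = below , _ , e≢ , on-finish

Γ-planar : Planar Γ
Γ-planar = record
  { pos             = pos
  ; injective       = pos-injective
  ; bends           = λ _ _ → []
  ; bends-sym       = λ _ _ → refl
  ; avoids-vertices = avoids-vertices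
  ; no-crossing     = no-crossing
  }
  where
  avoids-vertices : ∀ {u v w} → Adj u v → OnSegment (pos u) (pos v) (pos w) → w ≡ u ⊎ w ≡ v
  avoids-vertices {w = w} uv on with e , tr ← adj-traced uv with σ , k , e≢ , on′ ← spoke-through e w =
    Sum.map pos-injective pos-injective
      (traces-end tr (pieces-meet-at-ends e (spoke σ k) e≢ (traces-on tr on) on′))

  no-crossing : ∀ {u v u′ v′ r} → Adj u v → Adj u′ v′ →
                ¬ ((u ≡ u′ × v ≡ v′) ⊎ (u ≡ v′ × v ≡ u′)) →
                OnSegment (pos u) (pos v) r → OnSegment (pos u′) (pos v′) r → ∃[ w ] r ≡ pos w
  no-crossing {u} {v} uv u′v′ differ on on′ with e , tr ← adj-traced uv with e′ , tr′ ← adj-traced u′v′ =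
    [ u ,_ , v ,_ ]′ (traces-end tr (pieces-meet-at-ends e e′ (λ { refl → differ (traces-unique tr tr′) })
                                       (traces-on tr on) (traces-on tr′ on′)))

-- Girth

open DecMembership (≡-dec _≟_ _≟_) using (_∈?_)

joined? : ∀ c u v → Dec (Joined c u v)
joined? c u v = (u , v) ∈? edges c ⊎-dec (v , u) ∈? edges c

adj? : ∀ u v → Dec (Adj u v)
adj? u v = map′ [ 0ℙ ,_ , 1ℙ ,_ ]′ (λ { (0ℙ , e) → inj₁ e ; (1ℙ , e) → inj₂ e })
                (joined? 0ℙ u v ⊎-dec joined? 1ℙ u v)

4-cycle : Cycle Γ 4
4-cycle = record
  { 3≤n       = from-yes (3 ℕ.≤? 4)
  ; vertex    = vertex
  ; injective = λ {i} {j} → from-yes (Fin.all? λ i → Fin.all? λ j →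
                  (vertex i ≟ vertex j) →-dec (i Fin.≟ j)) i j
  ; step      = λ {i} {j} → from-yes (Fin.all? λ i → Fin.all? λ j →
                  (ℕ.suc (toℕ i) ℕ.≟ toℕ j) →-dec adj? (vertex i) (vertex j)) i j
  ; close     = λ {i} {j} → from-yes (Fin.all? λ i → Fin.all? λ j →
                  (ℕ.suc (toℕ i) ℕ.≟ 4) →-dec ((toℕ j ℕ.≟ 0) →-dec adj? (vertex i) (vertex j))) i j
  }
  where
  vertex : Fin 4 → Vertex
  vertex = Vec.lookup (x (# 0) ∷ a ∷ x (# 2) ∷ b ∷ [])

-- The bipartition of Γ: the vertices x₁, x₄, x₇, x₁₀ have only other x's as neighbours and so join
-- a, b, z. With values in `Parity`, crossing an edge is `_⁻¹`.
class : Vertex → Parity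
class a = 0ℙ
class b = 0ℙ
class z = 0ℙ
class (x i) with toℕ i
... | 1  = 0ℙ
... | 4  = 0ℙ
... | 7  = 0ℙ
... | 10 = 0ℙ
... | _  = 1ℙ

Bicolored : Vertex → Vertex → Set
Bicolored u v = class u ≡ class v ⁻¹

edges-bicolored : ∀ c → All (λ (u , v) → Bicolored u v) (edges c)
edges-bicolored 0ℙ = from-yes (all? (λ (u , v) → class u ℙ.≟ class v ⁻¹) (edges 0ℙ))
edges-bicolored 1ℙ = from-yes (all? (λ (u , v) → class u ℙ.≟ class v ⁻¹) (edges 1ℙ))

adj-bicolored : ∀ {u v} → Adj u v → Bicolored u v
adj-bicolored (c , inj₁ e) = lookup (edges-bicolored c) e
adj-bicolored {u} {v} (c , inj₂ e) = begin
  class u         ≡⟨ ℙ.⁻¹-involutive (class u) ⟨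
  class u ⁻¹ ⁻¹   ≡⟨ cong _⁻¹ (lookup (edges-bicolored c) e) ⟨
  class v ⁻¹      ∎
  where open ≡-Reasoning

-- Going once round a triangle flips the class three times.
triangle-free : ¬ Cycle Γ 3
triangle-free C = odd (class (vertex (# 0))) (begin
  class (vertex (# 0))           ≡⟨ adj-bicolored (step {# 0} {# 1} refl) ⟩
  class (vertex (# 1)) ⁻¹        ≡⟨ cong _⁻¹ (adj-bicolored (step {# 1} {# 2} refl)) ⟩
  class (vertex (# 2)) ⁻¹ ⁻¹     ≡⟨ cong (_⁻¹ ∘ _⁻¹) (adj-bicolored (close {# 2} {# 0} refl refl)) ⟩
  class (vertex (# 0)) ⁻¹ ⁻¹ ⁻¹  ∎)
  where
  open Cycle C
  open ≡-Reasoning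
  odd : ∀ p → p ≢ p ⁻¹ ⁻¹ ⁻¹
  odd 0ℙ ()
  odd 1ℙ ()

Γ-girth : HasGirth Γ 4
Γ-girth = 4-cycle , λ n C →
  -- The bound 4 ≤ n is by definition 3 < n.
  ℕ.≤∧≢⇒< (Cycle.3≤n C) λ { refl → triangle-free C }

-- Inversions

∀-parity? : ∀ {P : Parity → Set} → Decidable P → Dec (∀ p → P p)
∀-parity? P? = map′ (λ { (p₀ , p₁) 0ℙ → p₀ ; (p₀ , p₁) 1ℙ → p₁ }) (λ p → p 0ℙ , p 1ℙ)
                    (P? 0ℙ ×-dec P? 1ℙ)

-- Exhaustive search over 𝔽₂ⁿ, by which `orthogonal-to-two` is verified.
∀-vec? : ∀ {n} {P : Vec Parity n → Set} → Decidable P → Dec (∀ v → P v)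
∀-vec? {ℕ.zero}  P? = map′ (λ { p [] → p }) (λ p → p []) (P? [])
∀-vec? {ℕ.suc n} P? = map′ (λ { f (p ∷ v) → f p v }) (λ f p v → f (p ∷ v))
                           (∀-parity? λ p → ∀-vec? λ v → P? (p ∷ v))

0ᵛ : ∀ {t} → Vec Parity t
0ᵛ {t} = replicate t 0ℙ

·-zeroˡ : ∀ {t} (v : Vec Parity t) → 0ᵛ · v ≡ 0ℙ
·-zeroˡ []      = refl
·-zeroˡ (_ ∷ v) = ·-zeroˡ v

infix 7 _⨯_

-- The cross product; signs vanish over 𝔽₂.
_⨯_ : Vec Parity 3 → Vec Parity 3 → Vec Parity 3
(u₁ ∷ u₂ ∷ u₃ ∷ []) ⨯ (v₁ ∷ v₂ ∷ v₃ ∷ []) =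
  (u₂ ℙ.* v₃) ℙ.+ (u₃ ℙ.* v₂) ∷ (u₃ ℙ.* v₁) ℙ.+ (u₁ ℙ.* v₃) ∷ (u₁ ℙ.* v₂) ℙ.+ (u₂ ℙ.* v₁) ∷ []

-- Distinct nonzero vectors over 𝔽₂ are independent, so their orthogonal complement in 𝔽₂³ is a line
-- with one nonzero vector. All 512 triples are checked.
orthogonal-to-two : ∀ u v w → u ≢ 0ᵛ → v ≢ 0ᵛ → u ≢ v → w ≢ 0ᵛ →
                    w · u ≡ 0ℙ → w · v ≡ 0ℙ → w ≡ u ⨯ v
orthogonal-to-two = from-yes (∀-vec? λ u → ∀-vec? λ v → ∀-vec? λ w →
  ¬? (u ≟ᵛ 0ᵛ) →-dec (¬? (v ≟ᵛ 0ᵛ) →-dec (¬? (u ≟ᵛ v) →-dec (¬? (w ≟ᵛ 0ᵛ) →-dec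
  ((w · u ℙ.≟ 0ℙ) →-dec ((w · v ℙ.≟ 0ℙ) →-dec (w ≟ᵛ u ⨯ v)))))))
  where
  infix 4 _≟ᵛ_
  _≟ᵛ_ : (u v : Vec Parity 3) → Dec (u ≡ v)
  _≟ᵛ_ = Vec.≡-dec ℙ._≟_

no-3-inversion : ¬ Inversion Γ,π 3
no-3-inversion I = a≢b (trans (normal a a≢0 (dot 0ℙ a (x (# 0))) (dot 0ℙ a (x (# 2))))
                         (sym (normal b b≢0 (dot 0ℙ b (x (# 0))) (dot 0ℙ b (x (# 2))))))
  where
  open Inversion I

  -- For concrete vertices the implicit argument is solved by evaluation, so edges need not be
  -- exhibited.
  dot : ∀ c u v {_ : True (joined? c u v)} → vec u · vec v ≡ c
  dot c u v {e} = sym (inverts (c , toWitness e))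

  -- A zero vector would give the edge color 0.
  nonzero : ∀ u v {_ : True (joined? 1ℙ u v)} → vec u ≢ 0ᵛ
  nonzero u v {e} eq with () ← trans (sym (·-zeroˡ (vec v))) (subst (λ w → w · vec v ≡ 1ℙ) eq (dot 1ℙ u v {e}))

  -- The common neighbour `v` has different products with the two vectors.
  distinct : ∀ u u′ v {_ : True (joined? 0ℙ u v)} {_ : True (joined? 1ℙ u′ v)} → vec u ≢ vec u′
  distinct u u′ v {e} {e′} eq
    with () ← trans (sym (dot 0ℙ u v {e})) (trans (cong (_· vec v) eq) (dot 1ℙ u′ v {e′}))

  a≢0 : vec a ≢ 0ᵛ
  a≢0 = nonzero a (x (# 6))

  b≢0 : vec b ≢ 0ᵛ
  b≢0 = nonzero b (x (# 3))

  a≢b : vec a ≢ vec b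
  a≢b = distinct a b (x (# 3))

  normal : ∀ w → vec w ≢ 0ᵛ → vec w · vec (x (# 0)) ≡ 0ℙ → vec w · vec (x (# 2)) ≡ 0ℙ →
           vec w ≡ vec (x (# 0)) ⨯ vec (x (# 2))
  normal w = orthogonal-to-two (vec (x (# 0))) (vec (x (# 2))) (vec w)
    (nonzero (x (# 0)) z) (nonzero (x (# 2)) (x (# 1))) (distinct (x (# 0)) (x (# 2)) (x (# 1)))

proposition4p5 : Planar Γ × HasGirth Γ 4 × ¬ Inversion Γ,π 3
proposition4p5 = Γ-planar , Γ-girth , no-3-inversion
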